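{- For all integers $n\ge 1$ and $0\le k\le n-1$, $$|PF_{n,k}| = \sum_{\sigma\in S_n}\left(\prod_{i=1}^n \ell_k(i;\sigma)\right).$$
   Context: Write $[n]=\{1,\dots,n\}$. A street has parking spots $1,\dots,n$ in order, and cars $c_1,\dots,c_n$ arrive in this order. A parking preference is a tuple $\alpha=(a_1,\dots,a_n)\in[n]^n$, where $a_i$ is the preferred spot of $c_i$. $k$-Naples parking rule: car $c_i$ drives to spot $a_i$; if it is empty, $c_i$ parks there. If it is occupied, $c_i$ backs up one spot at a time, checking spots $a_i-1,a_i-2,\dots$ in turn, up to at most $k$ spots behind $a_i$ (and never past spot $1$), and parks in the first empty one it finds. If all of these spots are occupied, $c_i$ goes forward and parks in the first empty spot after $a_i$, if there is one; otherwise it fails to park. The preference $\alpha$ is a $k$-Naples parking function of length $n$ if all $n$ cars park under this rule; $PF_{n,k}$ is the set of all of these. $S_n$ is the symmetric group on $[n]$, with permutations in one-line notation. For $\sigma=s_1\cdots s_n\in S_n$ and $1\le i\le n$ (subsequences here are blocks of consecutive entries): - $\mathtt{left}_k(i;\sigma)$ is the length of the longest subsequence $s_j\cdots s_{i-1}$ such that $s_t<s_i$ for all $j\le t<i$ (equal to $0$ if it is empty). - $\mathtt{right}_k(i;\sigma)$ is the length of the longest subsequence $s_i\cdots s_r$ such that $r\le i+k$ (and $r\le n$) and $s_t\le s_i$ for all $i\le t\le r$. - $\ell_k(i;\sigma)=\mathtt{left}_k(i;\sigma)+\mathtt{right}_k(i;\sigma)$ if $\mathtt{left}_k(i;\sigma)=i-1$,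 and $\ell_k(i;\sigma)=\max(\mathtt{left}_k(i;\sigma)-k,0)+\mathtt{right}_k(i;\sigma)$ if $\mathtt{left}_k(i;\sigma)<i-1$. -}

module Defs where

open import Data.Bool using (if_then_else_)
open import Data.Fin as Fin using (Fin; toℕ; _<?_)
open import Data.Fin.Properties using (_≟_; all?; any?; _≤?_)
open import Data.Fin.Subset using (Subset; ⊥; ⁅_⁆; _∪_)
open import Data.Fin.Subset.Properties using (_∈?_)
open import Data.List.Base
  using (List; []; _∷_; [_]; _++_; allFin; cartesianProductWith; filter; find;
         reverse; take; upTo)
open import Data.List.Extrema.Nat using (max)
open import Data.List.Membership.Propositional using (_∈_)
open import Data.List.Membership.Propositional.Properties
  using (∈-allFin; ∈-cartesianProductWith⁺)
open import Data.List.Relation.Unary.All using ([])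
open import Data.List.Relation.Unary.AllPairs using ([]; _∷_)
open import Data.List.Relation.Unary.Any using (here)
open import Data.List.Relation.Unary.Unique.Propositional using (Unique)
import Data.List.Relation.Unary.Unique.Propositional.Properties as Unique
open import Data.Maybe using (Maybe; just; _>>=_; Is-just)
import Data.Maybe.Relation.Unary.Any as MaybeAny
open import Data.Nat as ℕ using (ℕ; zero; suc; _+_; _∸_)
import Data.Nat.Properties as ℕ
open import Data.Product using (_×_)
open import Data.Unit using (tt)
open import Data.Vec.Base using (Vec; []; _∷_; lookup)
open import Data.Vec.Properties using (∷-injective)
open import Function.Consequences.Propositional
  using (strictlySurjective⇒surjective; surjective⇒strictlySurjective)
open import Function.Definitions using (Bijective; Injective; Surjective)
open import Relation.Binary.PropositionalEquality using (_≡_; refl)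
open import Relation.Nullary using (Dec; yes)
open import Relation.Nullary.Decidable
  using (does; map′; ¬?; _×-dec_; _→-dec_)
open import Relation.Unary using (Decidable)

-- Spots, positions and entries 1, …, n are represented by Fin n, shifted down
-- by one: the element i : Fin n stands for toℕ i + 1.

------------------------------------------------------------------------
-- All words of length m over [n], each listed exactly once

words : ∀ n m → List (Vec (Fin n) m)
words n zero    = [ [] ]
words n (suc m) = cartesianProductWith _∷_ (allFin n) (words n m)

words-complete : ∀ {n m} (w : Vec (Fin n) m) → w ∈ words n m
words-complete []      = here refl
words-complete (a ∷ w) =
  ∈-cartesianProductWith⁺ _∷_ (∈-allFin a) (words-complete w)

words-unique : ∀ n m → Unique (words n m)
words-unique n zero    = [] ∷ []
words-unique n (suc m) =
  Unique.cartesianProductWith⁺ _∷_ ∷-injective (Unique.allFin⁺ n) (words-unique n m)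

------------------------------------------------------------------------
-- k-Naples parking functions

module _ {n : ℕ} where

  -- a - 1, a - 2, …, 1
  spotsBehind : Fin n → List (Fin n)
  spotsBehind a = reverse (filter (_<? a) (allFin n))

  -- a + 1, a + 2, …, n
  spotsAhead : Fin n → List (Fin n)
  spotsAhead a = filter (a <?_) (allFin n)

  -- The spots a car preferring a examines, in order: a itself, then at most k
  -- spots backwards, then everything in front of a.
  itinerary : ℕ → Fin n → List (Fin n)
  itinerary k a = a ∷ take k (spotsBehind a) ++ spotsAhead a

  -- Here and below, a Subset n is the set of occupied spots.
  parkCar : ℕ → Subset n → Fin n → Maybe (Fin n)
  parkCar k occ a = find (λ s → ¬? (s ∈? occ)) (itinerary k a)

  -- The occupied spots after all cars have parked, or nothing as soon as one
  -- of them fails to park.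
  parkAll : ∀ {m} → ℕ → Subset n → Vec (Fin n) m → Maybe (Subset n)
  parkAll k occ []       = just occ
  parkAll k occ (a ∷ as) =
    parkCar k occ a >>= λ s → parkAll k (occ ∪ ⁅ s ⁆) as

  IsNaplesPF : ℕ → Vec (Fin n) n → Set
  IsNaplesPF k α = Is-just (parkAll k ⊥ α)

  isNaplesPF? : ∀ k → Decidable (IsNaplesPF k)
  isNaplesPF? k α = MaybeAny.dec (λ _ → yes tt) (parkAll k ⊥ α)

PF : (n k : ℕ) → List (Vec (Fin n) n)
PF n k = filter (isNaplesPF? k) (words n n)

------------------------------------------------------------------------
-- The symmetric group, in one-line notation

module _ {n : ℕ} where

  IsPermutation : Vec (Fin n) n → Set
  IsPermutation σ = Bijective _≡_ _≡_ (lookup σ)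

  isPermutation? : Decidable IsPermutation
  isPermutation? σ = injective? ×-dec surjective?
    where
    injective? : Dec (Injective _≡_ _≡_ (lookup σ))
    injective? = map′ (λ inj {x} {y} → inj x y) (λ inj x y → inj {x} {y})
      (all? λ x → all? λ y → (lookup σ x ≟ lookup σ y) →-dec (x ≟ y))

    surjective? : Dec (Surjective _≡_ _≡_ (lookup σ))
    surjective? = map′ strictlySurjective⇒surjective surjective⇒strictlySurjective
      (all? λ y → any? λ x → lookup σ x ≟ y)

S : (n : ℕ) → List (Vec (Fin n) n)
S n = filter isPermutation? (words n n)

------------------------------------------------------------------------
-- The statistics left, right and ℓ

module _ {n : ℕ} (σ : Vec (Fin n) n) (i : Fin n) where

  -- The m entries immediately before position i exist and are all smaller
  -- than the entry at i.
  LeftBlock : ℕ → Set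
  LeftBlock m = m ℕ.≤ toℕ i ×
    (∀ t → toℕ i ∸ m ℕ.≤ toℕ t → t Fin.< i → lookup σ t Fin.< lookup σ i)

  -- The m entries starting at position i exist, do not go beyond position
  -- i + k, and are all at most the entry at i.
  RightBlock : ℕ → ℕ → Set
  RightBlock k m = (toℕ i + m ℕ.≤ n × m ℕ.≤ suc k) ×
    (∀ t → i Fin.≤ t → toℕ t ℕ.< toℕ i + m → lookup σ t Fin.≤ lookup σ i)

  leftBlock? : Decidable LeftBlock
  leftBlock? m = (m ℕ.≤? toℕ i) ×-dec
    all? λ t → (toℕ i ∸ m ℕ.≤? toℕ t) →-dec (t <? i) →-dec
               (lookup σ t <? lookup σ i)

  rightBlock? : ∀ k → Decidable (RightBlock k)
  rightBlock? k m = ((toℕ i + m ℕ.≤? n) ×-dec (m ℕ.≤? suc k)) ×-dec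
    all? λ t → (i ≤? t) →-dec (toℕ t ℕ.<? toℕ i + m) →-dec
               (lookup σ t ≤? lookup σ i)

  -- The bound n on the lengths searched is harmless: both kinds of block lie
  -- inside a word of length n.  The value of left does not depend on k.
  left : ℕ
  left = max 0 (filter leftBlock? (upTo (suc n)))

  right : ℕ → ℕ
  right k = max 0 (filter (rightBlock? k) (upTo (suc n)))

  -- toℕ i is the number of positions before i, and left never exceeds it, so
  -- the second branch is the case of left being smaller; truncated
  -- subtraction is max (left - k) 0.
  ℓ : ℕ → ℕ
  ℓ k = if does (left ℕ.≟ toℕ i)
        then left + right k
        else (left ∸ k) + right k

{-# OPTIONS --safe #-}
module Submission where

-- Group the parking functions by outcome, the sequence of spots taken by
-- c_1, c_2, ….  The number of preferences with a given outcome is the product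
-- over the cars of the number of spots a car may prefer so that, given the spots
-- already occupied, it ends up in its spot; this product vanishes when a spot
-- repeats.  Outcomes are therefore the inverses of the permutations σ listing
-- the cars by spot, and when the car at i arrives, the occupied spots are those
-- t with σ_t < σ_i.  The preferences leading to i then form an interval around i:
-- above i it is cut off by the first free spot and by i + k, giving right_k; below i
-- a car must not reach a free spot while backing up, so the lowest k spots
-- of the left block are lost unless that block extends to the first spot.

open import Defs
open import Data.Bool using (Bool; true; false; if_then_else_)
open import Data.Bool.Properties using (if-float)
open import Data.Empty using (⊥-elim)
open import Data.Fin as Fin using (Fin; zero; suc; toℕ; punchOut)
import Data.Fin.Properties as Fin
open import Data.Fin.Subset as Subset using (Subset; ⁅_⁆; _∪_) renaming (_∈_ to _∈ₛ_; _∉_ to _∉ₛ_)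
import Data.Fin.Subset.Properties as Subset
open import Data.List.Base
  using (List; []; _∷_; _++_; allFin; cartesianProductWith; filter; find; length; map;
         reverse; tabulate; take; upTo)
open import Data.List.Extrema.Nat using (max; xs≤max; argmax-sel)
open import Data.List.Membership.Propositional using (_∈_)
open import Data.List.Membership.Propositional.Properties
  using (∈-++⁺ˡ; ∈-++⁺ʳ; ∈-++⁻; ∈-allFin; ∈-filter⁺; ∈-filter⁻; ∈-map⁺; ∈-map⁻; ∈-upTo⁺)
open import Data.List.Membership.Propositional.Properties.WithK using (unique∧set⇒bag)
import Data.List.Properties as List
open import Data.List.Relation.Binary.BagAndSetEquality using (∼bag⇒↭)
open import Data.List.Relation.Binary.Permutation.Propositional using (_↭_; ↭-sym)
open import Data.List.Relation.Binary.Permutation.Propositional.Properties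
  using (All-resp-↭; ∈-resp-↭; ↭-length; ↭-reverse; filter-↭; map⁺)
open import Data.List.Relation.Unary.All as All using (All; []; _∷_)
import Data.List.Relation.Unary.All.Properties as All
open import Data.List.Relation.Unary.AllPairs using (AllPairs; []; _∷_)
import Data.List.Relation.Unary.AllPairs.Properties as AllPairs
open import Data.List.Relation.Unary.Any using (here; there)
open import Data.List.Relation.Unary.Unique.Propositional using (Unique)
import Data.List.Relation.Unary.Unique.Propositional.Properties as Unique
open import Data.Maybe using (Maybe; just; nothing; maybe′; _>>=_)
import Data.Maybe.Properties as Maybe
import Data.Maybe.Relation.Unary.Any as MaybeAny
open import Data.Nat using (ℕ; zero; suc; _+_; _*_; _∸_; _≤_; _<_; z≤n; s≤s; s≤s⁻¹; _≤?_; _<?_)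
open import Data.Nat.ListAction using (product; sum)
open import Data.Nat.ListAction.Properties using (sum-++; sum-↭; product-↭)
open import Data.Nat.Properties
open import Data.Product using (∃; _×_; _,_; proj₁; proj₂; uncurry)
open import Data.Sum using (_⊎_; inj₁; inj₂; [_,_]′)
open import Data.Unit using (tt)
open import Data.Vec.Base as Vec using (Vec; []; _∷_; lookup)
import Data.Vec.Properties as Vec
open import Function using (_∘_; id; flip; _⇔_; mk⇔; Equivalence)
open import Function.Consequences.Propositional using (strictlySurjective⇒surjective)
open import Function.Definitions using (Injective)
open import Relation.Binary.Core using (Rel)
open import Relation.Binary.Definitions using (Asymmetric; tri<; tri≈; tri>)
import Relation.Binary.Definitions as B
open import Relation.Binary.PropositionalEquality
  using (_≡_; _≢_; refl; sym; trans; cong; cong₂; subst; module ≡-Reasoning)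
open import Relation.Nullary using (¬_; yes; no; does; contradiction)
open import Relation.Nullary.Decidable using (¬?; _×-dec_; dec-true; dec-false; decidable-stable)
open import Relation.Unary using (Decidable; Pred)
open import Level using (0ℓ)

private variable
  A B C : Set
  n m : ℕ

-- Finite sums

∑ : List A → (A → ℕ) → ℕ
∑ xs f = sum (map f xs)

∑-cong : ∀ {f g : A → ℕ} xs → (∀ x → f x ≡ g x) → ∑ xs f ≡ ∑ xs g
∑-cong xs f≗g = cong sum (List.map-cong f≗g xs)

∑-zero : ∀ (xs : List A) → ∑ xs (λ _ → 0) ≡ 0
∑-zero []       = refl
∑-zero (x ∷ xs) = ∑-zero xs

∑-+ : ∀ (f g : A → ℕ) xs → ∑ xs (λ x → f x + g x) ≡ ∑ xs f + ∑ xs g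
∑-+ f g []       = refl
∑-+ f g (x ∷ xs) = begin
  f x + g x + ∑ xs (λ y → f y + g y)  ≡⟨ cong (f x + g x +_) (∑-+ f g xs) ⟩
  f x + g x + (∑ xs f + ∑ xs g)       ≡⟨ +-assoc (f x) (g x) _ ⟩
  f x + (g x + (∑ xs f + ∑ xs g))     ≡⟨ cong (f x +_) (+-assoc (g x) _ _) ⟨
  f x + (g x + ∑ xs f + ∑ xs g)       ≡⟨ cong (λ z → f x + (z + ∑ xs g)) (+-comm (g x) _) ⟩
  f x + (∑ xs f + g x + ∑ xs g)       ≡⟨ cong (f x +_) (+-assoc (∑ xs f) _ _) ⟩
  f x + (∑ xs f + (g x + ∑ xs g))     ≡⟨ +-assoc (f x) _ _ ⟨
  f x + ∑ xs f + (g x + ∑ xs g)       ∎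
  where open ≡-Reasoning

∑-*ˡ : ∀ c (f : A → ℕ) xs → ∑ xs (λ x → c * f x) ≡ c * ∑ xs f
∑-*ˡ c f []       = sym (*-zeroʳ c)
∑-*ˡ c f (x ∷ xs) =
  trans (cong (c * f x +_) (∑-*ˡ c f xs)) (sym (*-distribˡ-+ c (f x) _))

∑-++ : ∀ (f : A → ℕ) xs ys → ∑ (xs ++ ys) f ≡ ∑ xs f + ∑ ys f
∑-++ f xs ys = trans (cong sum (List.map-++ f xs ys)) (sum-++ (map f xs) _)

∑-cartesianProductWith : ∀ (f : A → B → C) (g : C → ℕ) xs ys →
  ∑ (cartesianProductWith f xs ys) g ≡ ∑ xs (λ x → ∑ ys (λ y → g (f x y)))
∑-cartesianProductWith f g []       ys = refl
∑-cartesianProductWith f g (x ∷ xs) ys = begin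
  ∑ (map (f x) ys ++ cartesianProductWith f xs ys) g
    ≡⟨ ∑-++ g (map (f x) ys) _ ⟩
  ∑ (map (f x) ys) g + ∑ (cartesianProductWith f xs ys) g
    ≡⟨ cong₂ _+_ (cong sum (sym (List.map-∘ ys))) (∑-cartesianProductWith f g xs ys) ⟩
  ∑ ys (g ∘ f x) + ∑ xs (λ x → ∑ ys (λ y → g (f x y))) ∎
  where open ≡-Reasoning

∑-filter : ∀ {P : Pred A 0ℓ} (P? : Decidable P) {f : A → ℕ} xs →
  (∀ x → ¬ P x → f x ≡ 0) → ∑ (filter P? xs) f ≡ ∑ xs f
∑-filter P? []       f≡0 = refl
∑-filter P? {f} (x ∷ xs) f≡0 with P? x
... | yes _  = cong (f x +_) (∑-filter P? xs f≡0)
... | no ¬px = trans (∑-filter P? xs f≡0) (cong (_+ ∑ xs f) (sym (f≡0 x ¬px)))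

𝟙 : Bool → ℕ
𝟙 b = if b then 1 else 0

length-filter-∷ : ∀ {P : Pred A 0ℓ} (P? : Decidable P) x xs →
  length (filter P? (x ∷ xs)) ≡ 𝟙 (does (P? x)) + length (filter P? xs)
length-filter-∷ P? x xs with does (P? x)
... | true  = refl
... | false = refl

length-filter≡∑ : ∀ {P : Pred A 0ℓ} (P? : Decidable P) xs →
  length (filter P? xs) ≡ ∑ xs (λ x → 𝟙 (does (P? x)))
length-filter≡∑ P? []       = refl
length-filter≡∑ P? (x ∷ xs) =
  trans (length-filter-∷ P? x xs) (cong (𝟙 (does (P? x)) +_) (length-filter≡∑ P? xs))

allFin-suc : ∀ n → allFin (suc n) ≡ zero ∷ map suc (allFin n)
allFin-suc n = cong (zero ∷_) (sym (List.map-tabulate id suc))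

∑-allFin-suc : ∀ (f : Fin (suc n) → ℕ) → ∑ (allFin (suc n)) f ≡ f zero + ∑ (allFin n) (f ∘ suc)
∑-allFin-suc {n} f =
  trans (cong (λ xs → ∑ xs f) (allFin-suc n)) (cong (λ xs → f zero + sum xs) (sym (List.map-∘ (allFin n))))

∑-indicator : ∀ (i : Fin n) (f : Fin n → ℕ) →
  ∑ (allFin n) (λ j → 𝟙 (does (i Fin.≟ j)) * f j) ≡ f i
∑-indicator {suc n} zero f = begin
  ∑ (allFin (suc n)) (λ j → 𝟙 (does (zero Fin.≟ j)) * f j)  ≡⟨ ∑-allFin-suc (λ j → 𝟙 (does (zero Fin.≟ j)) * f j) ⟩
  1 * f zero + ∑ (allFin n) (λ _ → 0)  ≡⟨ cong₂ _+_ (*-identityˡ _) (∑-zero (allFin n)) ⟩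
  f zero + 0                           ≡⟨ +-identityʳ _ ⟩
  f zero                               ∎
  where open ≡-Reasoning
∑-indicator {suc n} (suc i) f =
  trans (∑-allFin-suc (λ j → 𝟙 (does (suc i Fin.≟ j)) * f j)) (∑-indicator i (f ∘ suc))

_≟ₘ_ : B.DecidableEquality (Maybe (Fin n))
_≟ₘ_ = Maybe.≡-dec Fin._≟_

∑-indicator-maybe : ∀ (x : Maybe (Fin n)) (f : Fin n → ℕ) →
  ∑ (allFin n) (λ j → 𝟙 (does (x ≟ₘ just j)) * f j) ≡ maybe′ f 0 x
∑-indicator-maybe {n} nothing  f = ∑-zero (allFin n)
∑-indicator-maybe (just i) f = ∑-indicator i f

-- Double counting over the values of `g`: each `j` is hit once for every entry in its fibre, and
-- entries sent to `nothing` contribute 0. With `g` the map from a preference to the spot taken,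
-- this turns sums over preferences into sums over spots.
∑-fibres : ∀ (g : A → Maybe (Fin n)) (f : Fin n → ℕ) xs →
  ∑ xs (maybe′ f 0 ∘ g) ≡
  ∑ (allFin n) (λ j → length (filter (λ x → g x ≟ₘ just j) xs) * f j)
∑-fibres {n = n} g f []       = sym (∑-zero (allFin n))
∑-fibres {n = n} g f (x ∷ xs) = begin
  maybe′ f 0 (g x) + ∑ xs (maybe′ f 0 ∘ g)
    ≡⟨ cong₂ _+_ (sym (∑-indicator-maybe (g x) f)) (∑-fibres g f xs) ⟩
  ∑ (allFin n) (λ j → 𝟙 (does (g x ≟ₘ just j)) * f j) + ∑ (allFin n) (λ j → # j xs * f j)
    ≡⟨ ∑-+ _ _ (allFin n) ⟨
  ∑ (allFin n) (λ j → 𝟙 (does (g x ≟ₘ just j)) * f j + # j xs * f j)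
    ≡⟨ ∑-cong (allFin n) (λ j → sym (*-distribʳ-+ (f j) (𝟙 (does (g x ≟ₘ just j))) _)) ⟩
  ∑ (allFin n) (λ j → (𝟙 (does (g x ≟ₘ just j)) + # j xs) * f j)
    ≡⟨ ∑-cong (allFin n) (λ j → cong (_* f j) (sym (length-filter-∷ (λ y → g y ≟ₘ just j) x xs))) ⟩
  ∑ (allFin n) (λ j → # j (x ∷ xs) * f j) ∎
  where
  open ≡-Reasoning
  # : Fin n → List _ → ℕ
  # j ys = length (filter (λ y → g y ≟ₘ just j) ys)

-- Filtering, sorting and searching lists

filter-filter : ∀ {P Q : Pred A 0ℓ} (P? : Decidable P) (Q? : Decidable Q) xs →
  filter P? (filter Q? xs) ≡ filter (λ x → P? x ×-dec Q? x) xs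
filter-filter P? Q? [] = refl
filter-filter P? Q? (x ∷ xs) with Q? x
... | yes q with P? x
...   | yes p = cong (x ∷_) (filter-filter P? Q? xs)
...   | no _  = filter-filter P? Q? xs
filter-filter P? Q? (x ∷ xs) | no _ with P? x
...   | yes p = filter-filter P? Q? xs
...   | no _  = filter-filter P? Q? xs

length-filter-map : ∀ {P : Pred B 0ℓ} (P? : Decidable P) (f : A → B) xs →
  length (filter P? (map f xs)) ≡ length (filter (P? ∘ f) xs)
length-filter-map P? f []       = refl
length-filter-map P? f (x ∷ xs) with does (P? (f x))
... | true  = cong suc (length-filter-map P? f xs)
... | false = length-filter-map P? f xs

inInterval? : ∀ lo hi → Decidable (λ (i : Fin n) → lo ≤ toℕ i × toℕ i < hi)
inInterval? lo hi i = (lo ≤? toℕ i) ×-dec (toℕ i <? hi)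

length-interval : ∀ n lo hi → hi ≤ n →
  length (filter (inInterval? lo hi) (allFin n)) ≡ hi ∸ lo
length-interval n lo zero hi≤n =
  trans (cong length (List.filter-none (inInterval? lo 0) (All.universal (λ { _ (_ , ()) }) (allFin n))))
        (sym (0∸n≡0 lo))
length-interval (suc n) zero (suc hi) (s≤s hi≤n) = begin
  length (filter (inInterval? 0 (suc hi)) (allFin (suc n)))
    ≡⟨ cong (λ xs → length (filter (inInterval? 0 (suc hi)) xs)) (allFin-suc n) ⟩
  suc (length (filter (inInterval? 0 (suc hi)) (map suc (allFin n))))
    ≡⟨ cong suc (length-filter-map (inInterval? 0 (suc hi)) suc (allFin n)) ⟩
  suc (length (filter (inInterval? 0 (suc hi) ∘ suc) (allFin n)))
    ≡⟨ cong (suc ∘ length) (List.filter-≐ (inInterval? 0 (suc hi) ∘ suc) (inInterval? 0 hi)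
         ((λ { (_ , s≤s q) → z≤n , q }) , (λ { (_ , q) → z≤n , s≤s q })) (allFin n)) ⟩
  suc (length (filter (inInterval? 0 hi) (allFin n)))
    ≡⟨ cong suc (length-interval n 0 hi hi≤n) ⟩
  suc hi ∎
  where open ≡-Reasoning
length-interval (suc n) (suc lo) (suc hi) (s≤s hi≤n) = begin
  length (filter (inInterval? (suc lo) (suc hi)) (allFin (suc n)))
    ≡⟨ cong (λ xs → length (filter (inInterval? (suc lo) (suc hi)) xs)) (allFin-suc n) ⟩
  length (filter (inInterval? (suc lo) (suc hi)) (map suc (allFin n)))
    ≡⟨ length-filter-map (inInterval? (suc lo) (suc hi)) suc (allFin n) ⟩
  length (filter (inInterval? (suc lo) (suc hi) ∘ suc) (allFin n))
    ≡⟨ cong length (List.filter-≐ (inInterval? (suc lo) (suc hi) ∘ suc) (inInterval? lo hi)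
         ((λ { (s≤s p , s≤s q) → p , q }) , (λ { (p , q) → s≤s p , s≤s q })) (allFin n)) ⟩
  length (filter (inInterval? lo hi) (allFin n))
    ≡⟨ length-interval n lo hi hi≤n ⟩
  hi ∸ lo ∎
  where open ≡-Reasoning

reverse-AllPairs : ∀ {R : Rel A 0ℓ} {xs} → AllPairs R xs → AllPairs (flip R) (reverse xs)
reverse-AllPairs []                           = []
reverse-AllPairs {xs = x ∷ xs} (Rx ∷ Rxs) rewrite List.unfold-reverse x xs =
  AllPairs.++⁺ (reverse-AllPairs Rxs) ([] ∷ []) (All.map (_∷ []) (All-resp-↭ (↭-sym (↭-reverse xs)) Rx))

AllPairs-map-local : ∀ {P : Pred A 0ℓ} {R T : Rel A 0ℓ} →
  (∀ {x y} → P x → P y → R x y → T x y) → ∀ {xs} → All P xs → AllPairs R xs → AllPairs T xs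
AllPairs-map-local f []         []         = []
AllPairs-map-local f (px ∷ pxs) (Rx ∷ Rxs) =
  All.zipWith (uncurry (f px)) (pxs , Rx) ∷ AllPairs-map-local f pxs Rxs

-- Searching and truncating lists sorted by an asymmetric relation

module _ {R : Rel A 0ℓ} (asym : Asymmetric R) where

  module _ {P : Pred A 0ℓ} (P? : Decidable P) where

    -- In a sorted list, "first" can be expressed by the order alone: the search result is the
    -- element satisfying `P` that has no predecessor satisfying `P`. Together with the converse
    -- below, this frees later arguments from positions in the list.
    find-sorted⁻ : ∀ {xs x} → AllPairs R xs → find P? xs ≡ just x →
      x ∈ xs × P x × (∀ {y} → y ∈ xs → R y x → ¬ P y)
    find-sorted⁻ {z ∷ xs} (Rz ∷ Rxs) eq with P? z
    find-sorted⁻ {z ∷ xs} (Rz ∷ Rxs) refl | yes pz = here refl , pz ,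
      λ { (here refl) r → contradiction r (asym r)
        ; (there y∈) r → contradiction r (asym (All.lookup Rz y∈)) }
    ... | no ¬pz with x∈ , px , before ← find-sorted⁻ Rxs eq = there x∈ , px ,
      λ { (here refl) _ → ¬pz ; (there y∈) → before y∈ }

    find-sorted⁺ : ∀ {xs x} → AllPairs R xs →
      x ∈ xs → P x → (∀ {y} → y ∈ xs → R y x → ¬ P y) → find P? xs ≡ just x
    find-sorted⁺ {z ∷ xs} (Rz ∷ Rxs) x∈ px before with P? z
    find-sorted⁺ (Rz ∷ Rxs) (here refl) px before | yes _ = refl
    find-sorted⁺ (Rz ∷ Rxs) (there x∈) px before | yes pz =
      contradiction pz (before (here refl) (All.lookup Rz x∈))
    find-sorted⁺ (Rz ∷ Rxs) (here refl) px before | no ¬pz = contradiction px ¬pz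
    find-sorted⁺ (Rz ∷ Rxs) (there x∈) px before | no _ =
      find-sorted⁺ Rxs x∈ px (before ∘ there)

  module _ (R? : B.Decidable R) where

    -- For an element of a sorted list this is its index, so `take k` keeps exactly the elements
    -- with fewer than `k` precursors.
    precursors : A → List A → ℕ
    precursors x xs = length (filter (λ y → R? y x) xs)

    precursors-head : ∀ {x xs} → AllPairs R (x ∷ xs) → precursors x (x ∷ xs) ≡ 0
    precursors-head {x} (Rx ∷ _) = cong length (List.filter-none (λ y → R? y x)
      ((λ r → asym r r) ∷ All.map (λ r r′ → asym r r′) Rx))

    ∈-take-sorted⁻ : ∀ k {xs x} → AllPairs R xs → x ∈ take k xs → x ∈ xs × precursors x xs < k
    ∈-take-sorted⁻ (suc k) {z ∷ xs} Rxs (here refl) =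
      here refl , subst (_< suc k) (sym (precursors-head Rxs)) (s≤s z≤n)
    ∈-take-sorted⁻ (suc k) {z ∷ xs} {x} (Rz ∷ Rxs) (there x∈)
      with x∈xs , lt ← ∈-take-sorted⁻ k Rxs x∈
      rewrite List.filter-accept (λ y → R? y x) {xs = xs} (All.lookup Rz x∈xs) = there x∈xs , s≤s lt

    ∈-take-sorted⁺ : ∀ k {xs x} → AllPairs R xs → x ∈ xs → precursors x xs < k → x ∈ take k xs
    ∈-take-sorted⁺ (suc k) Rxs (here refl) lt = here refl
    ∈-take-sorted⁺ (suc k) {z ∷ xs} {x} (Rz ∷ Rxs) (there x∈) lt
      rewrite List.filter-accept (λ y → R? y x) {xs = xs} (All.lookup Rz x∈) with lt
    ... | s≤s lt′ = there (∈-take-sorted⁺ k Rxs x∈ lt′)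

-- The parking rule

allFin-sorted : AllPairs Fin._<_ (allFin n)
allFin-sorted = AllPairs.tabulate⁺-< id

-- The order in which spots are examined

module _ (k : ℕ) {n : ℕ} (a : Fin n) where

  -- The car goes down from `a` and then up from the spot after `a`; this is that order on all spots
  -- of the street. The cutoff after `k` backward steps is recorded separately, by membership in the
  -- itinerary.
  ExaminedBefore : Rel (Fin n) 0ℓ
  ExaminedBefore b c = (b Fin.≤ a × (c Fin.< b ⊎ a Fin.< c)) ⊎ (a Fin.< b × b Fin.< c)

  examinedBefore-asym : Asymmetric ExaminedBefore
  examinedBefore-asym (inj₁ (_ , inj₁ c<b)) (inj₁ (_ , inj₁ b<c)) = <-asym c<b b<c
  examinedBefore-asym (inj₁ (b≤a , inj₁ _)) (inj₁ (_ , inj₂ a<b)) = <⇒≱ a<b b≤a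
  examinedBefore-asym (inj₁ (b≤a , inj₁ _)) (inj₂ (a<c , c<b)) = <⇒≱ (<-trans a<c c<b) b≤a
  examinedBefore-asym (inj₁ (_ , inj₂ a<c)) (inj₁ (c≤a , _)) = <⇒≱ a<c c≤a
  examinedBefore-asym (inj₁ (b≤a , inj₂ _)) (inj₂ (a<c , c<b)) = <⇒≱ (<-trans a<c c<b) b≤a
  examinedBefore-asym (inj₂ (a<b , b<c)) (inj₁ (c≤a , _)) = <⇒≱ (<-trans a<b b<c) c≤a
  examinedBefore-asym (inj₂ (_ , b<c)) (inj₂ (_ , c<b)) = <-asym b<c c<b

  spotsBehind-sorted : AllPairs Fin._>_ (spotsBehind a)
  spotsBehind-sorted = reverse-AllPairs (AllPairs.filter⁺ (Fin._<? a) allFin-sorted)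

  ∈-spotsBehind⁺ : ∀ {b} → b Fin.< a → b ∈ spotsBehind a
  ∈-spotsBehind⁺ b<a = ∈-resp-↭ (↭-sym (↭-reverse _)) (∈-filter⁺ (Fin._<? a) (∈-allFin _) b<a)

  ∈-spotsBehind⁻ : ∀ {b} → b ∈ spotsBehind a → b Fin.< a
  ∈-spotsBehind⁻ b∈ =
    proj₂ (∈-filter⁻ (Fin._<? a) {xs = allFin n} (∈-resp-↭ (↭-reverse _) b∈))

  ∈-spotsAhead⁺ : ∀ {b} → a Fin.< b → b ∈ spotsAhead a
  ∈-spotsAhead⁺ a<b = ∈-filter⁺ (a Fin.<?_) (∈-allFin _) a<b

  ∈-spotsAhead⁻ : ∀ {b} → b ∈ spotsAhead a → a Fin.< b
  ∈-spotsAhead⁻ b∈ = proj₂ (∈-filter⁻ (a Fin.<?_) {xs = allFin n} b∈)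

  -- The precursors of `b` are the spots strictly between `b` and `a`; reversing the list does not
  -- change their number.
  precursors-behind : ∀ b →
    precursors {R = Fin._>_} <-asym (flip Fin._<?_) b (spotsBehind a) ≡ toℕ a ∸ suc (toℕ b)
  precursors-behind b = begin
    length (filter (b Fin.<?_) (reverse (filter (Fin._<? a) (allFin n))))
      ≡⟨ ↭-length (filter-↭ (b Fin.<?_) (↭-reverse (filter (Fin._<? a) (allFin n)))) ⟩
    length (filter (b Fin.<?_) (filter (Fin._<? a) (allFin n)))
      ≡⟨ cong length (filter-filter (b Fin.<?_) (Fin._<? a) (allFin n)) ⟩
    length (filter (λ c → (b Fin.<? c) ×-dec (c Fin.<? a)) (allFin n))
      ≡⟨ cong length (List.filter-≐ (λ c → (b Fin.<? c) ×-dec (c Fin.<? a))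
           (inInterval? (suc (toℕ b)) (toℕ a)) (id , id) (allFin n)) ⟩
    length (filter (inInterval? (suc (toℕ b)) (toℕ a)) (allFin n))
      ≡⟨ length-interval n (suc (toℕ b)) (toℕ a) (<⇒≤ (Fin.toℕ<n a)) ⟩
    toℕ a ∸ suc (toℕ b) ∎
    where open ≡-Reasoning

  -- Here and in the converse, one inequality covers both directions of travel: it is automatic for
  -- spots ahead of `a`, and a spot `b` behind `a` has `a - b - 1` precursors, so `take k` keeps it
  -- exactly when `a - b` is at most `k`.
  ∈-itinerary⁻ : ∀ {b} → b ∈ itinerary k a → toℕ a ≤ toℕ b + k
  ∈-itinerary⁻ (here refl) = m≤m+n _ k
  ∈-itinerary⁻ {b} (there b∈) with ∈-++⁻ (take k (spotsBehind a)) b∈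
  ... | inj₂ b∈ahead = m≤n⇒m≤n+o k (<⇒≤ (∈-spotsAhead⁻ b∈ahead))
  ... | inj₁ b∈take
    with b∈behind , lt ← ∈-take-sorted⁻ <-asym (flip Fin._<?_) k spotsBehind-sorted b∈take = begin
    toℕ a                                  ≤⟨ m≤n+m∸n (toℕ a) (suc (toℕ b)) ⟩
    suc (toℕ b) + (toℕ a ∸ suc (toℕ b))    ≡⟨ +-suc (toℕ b) _ ⟨
    toℕ b + suc (toℕ a ∸ suc (toℕ b))      ≤⟨ +-monoʳ-≤ (toℕ b) (subst (_< k) (precursors-behind b) lt) ⟩
    toℕ b + k                              ∎
    where open ≤-Reasoning

  ∈-itinerary⁺ : ∀ {b} → toℕ a ≤ toℕ b + k → b ∈ itinerary k a
  ∈-itinerary⁺ {b} a≤b+k with Fin.<-cmp a b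
  ... | tri≈ _ refl _ = here refl
  ... | tri< a<b _ _ = there (∈-++⁺ʳ (take k (spotsBehind a)) (∈-spotsAhead⁺ a<b))
  ... | tri> _ _ b<a = there (∈-++⁺ˡ (∈-take-sorted⁺ <-asym (flip Fin._<?_) k spotsBehind-sorted
    (∈-spotsBehind⁺ b<a) (subst (_< k) (sym (precursors-behind b)) (begin
      suc (toℕ a ∸ suc (toℕ b))  ≡⟨ +-∸-assoc 1 b<a ⟨
      toℕ a ∸ toℕ b              ≤⟨ m≤n+o⇒m∸n≤o (toℕ a) (toℕ b) a≤b+k ⟩
      k                          ∎))))
    where open ≤-Reasoning

  itinerary-sorted : AllPairs ExaminedBefore (itinerary k a)
  itinerary-sorted = All.++⁺ (All.take⁺ k (All.map (λ b<a → inj₁ (≤-refl , inj₁ b<a)) allBehind))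
                             (All.map (λ a<b → inj₁ (≤-refl , inj₂ a<b)) allAhead)
    ∷ AllPairs.++⁺
        (AllPairs.take⁺ k (AllPairs-map-local (λ b<a _ c<b → inj₁ (<⇒≤ b<a , inj₁ c<b))
          allBehind spotsBehind-sorted))
        (AllPairs-map-local (λ a<b _ b<c → inj₂ (a<b , b<c))
          allAhead (AllPairs.filter⁺ (a Fin.<?_) allFin-sorted))
        (All.take⁺ k (All.map (λ b<a → All.map (λ a<c → inj₁ (<⇒≤ b<a , inj₂ a<c)) allAhead) allBehind))
    where
    allBehind : All (Fin._< a) (spotsBehind a)
    allBehind = All.tabulate ∈-spotsBehind⁻
    allAhead : All (a Fin.<_) (spotsAhead a)
    allAhead = All.tabulate ∈-spotsAhead⁻

-- The last two components split the spots examined before s into those above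
-- s (only possible if a ≥ s) and those below s (only possible if a < s).
Reaches : ℕ → Subset n → Fin n → Fin n → Set
Reaches k occ a s = toℕ a ≤ toℕ s + k
  × (∀ b → s Fin.< b → b Fin.≤ a → b ∈ₛ occ)
  × (a Fin.< s → ∀ b → b Fin.< s → toℕ a ≤ toℕ b + k → b ∈ₛ occ)

parkCar⇒free : ∀ k (occ : Subset n) a {s} → parkCar k occ a ≡ just s → s ∉ₛ occ
parkCar⇒free k occ a eq = proj₁ (proj₂ (find-sorted⁻ (examinedBefore-asym k a)
  (λ s → ¬? (s Subset.∈? occ)) (itinerary-sorted k a) eq))

parkCar⇒Reaches : ∀ k (occ : Subset n) a {s} → parkCar k occ a ≡ just s → Reaches k occ a s
parkCar⇒Reaches k occ a {s} eq
  with s∈ , _ , before ← find-sorted⁻ (examinedBefore-asym k a)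
         (λ s → ¬? (s Subset.∈? occ)) (itinerary-sorted k a) eq = a≤s+k , above , below
  where
  a≤s+k = ∈-itinerary⁻ k a s∈
  occupied : ∀ b → toℕ a ≤ toℕ b + k → ExaminedBefore k a b s → b ∈ₛ occ
  occupied b a≤b+k b≺s = decidable-stable (b Subset.∈? occ) (before (∈-itinerary⁺ k a a≤b+k) b≺s)
  above : ∀ b → s Fin.< b → b Fin.≤ a → b ∈ₛ occ
  above b s<b b≤a = occupied b (≤-trans a≤s+k (+-monoˡ-≤ k (<⇒≤ s<b))) (inj₁ (b≤a , inj₁ s<b))
  below : a Fin.< s → ∀ b → b Fin.< s → toℕ a ≤ toℕ b + k → b ∈ₛ occ
  -- A car preferring a spot below `s` examines both the spots up to `a` within its range and those
  -- strictly between `a` and `s` before it gets to `s`.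
  below a<s b b<s a≤b+k with b Fin.≤? a
  ... | yes b≤a = occupied b a≤b+k (inj₁ (b≤a , inj₂ a<s))
  ... | no  b≰a = occupied b a≤b+k (inj₂ (≰⇒> b≰a , b<s))

Reaches⇒parkCar : ∀ k (occ : Subset n) a {s} →
  s ∉ₛ occ → Reaches k occ a s → parkCar k occ a ≡ just s
Reaches⇒parkCar k occ a {s} s∉occ (a≤s+k , above , below) =
  find-sorted⁺ (examinedBefore-asym k a) (λ s → ¬? (s Subset.∈? occ))
    (itinerary-sorted k a) (∈-itinerary⁺ k a a≤s+k) s∉occ before
  where
  before : ∀ {b} → b ∈ itinerary k a → ExaminedBefore k a b s → ¬ b ∉ₛ occ
  before b∈ (inj₁ (b≤a , inj₁ s<b)) b∉occ = b∉occ (above _ s<b b≤a)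
  before b∈ (inj₁ (b≤a , inj₂ a<s)) b∉occ =
    b∉occ (below a<s _ (≤-<-trans b≤a a<s) (∈-itinerary⁻ k a b∈))
  before b∈ (inj₂ (a<b , b<s)) b∉occ =
    b∉occ (below (<-trans a<b b<s) _ b<s (∈-itinerary⁻ k a b∈))

-- Counting the preferences that lead to a given spot

-- The hypothesis `P 0` covers the default value: `max 0` returns either a candidate or 0, and both
-- must satisfy `P`.
max-filter-upTo : ∀ {P : Pred ℕ 0ℓ} (P? : Decidable P) n → P 0 →
  P (max 0 (filter P? (upTo (suc n)))) ×
  (∀ {m} → m ≤ n → P m → m ≤ max 0 (filter P? (upTo (suc n))))
max-filter-upTo {P} P? n p0 = holds , maximal
  where
  candidates = filter P? (upTo (suc n))
  holds : P (max 0 candidates)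
  holds with argmax-sel id 0 candidates
  ... | inj₁ max≡0 = subst P (sym max≡0) p0
  ... | inj₂ max∈  = proj₂ (∈-filter⁻ P? {xs = upTo (suc n)} max∈)
  maximal : ∀ {m} → m ≤ n → P m → m ≤ max 0 candidates
  maximal m≤n pm = All.lookup (xs≤max 0 candidates) (∈-filter⁺ P? (∈-upTo⁺ (s≤s m≤n)) pm)

preferences : ℕ → Subset n → Fin n → ℕ
preferences {n} k occ s = length (filter (λ a → parkCar k occ a ≟ₘ just s) (allFin n))

preferences-occupied : ∀ k (occ : Subset n) {s} → s ∈ₛ occ → preferences k occ s ≡ 0
preferences-occupied {n} k occ {s} s∈occ =
  cong length (List.filter-none (λ a → parkCar k occ a ≟ₘ just s)
    (All.universal (λ a eq → parkCar⇒free k occ a eq s∈occ) (allFin n)))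

module _ (k : ℕ) {n : ℕ} (σ : Vec (Fin n) n) (σ-injective : Injective _≡_ _≡_ (lookup σ))
         (i : Fin n) {occ : Subset n}
         (occ⁺ : ∀ b → lookup σ b Fin.< lookup σ i → b ∈ₛ occ)
         (occ⁻ : ∀ b → b ∈ₛ occ → lookup σ b Fin.< lookup σ i) where

  private
    p L R : ℕ
    p = toℕ i
    L = left σ i
    R = right σ i k

  -- The number of preferences a < i that lead to i.
  backward : ℕ
  backward = if does (L ≟ p) then L else L ∸ k

  backward-full : L ≡ p → backward ≡ L
  backward-full L≡p = cong (if_then L else L ∸ k) (dec-true (L ≟ p) L≡p)

  backward-partial : L ≢ p → backward ≡ L ∸ k
  backward-partial L≢p = cong (if_then L else L ∸ k) (dec-false (L ≟ p) L≢p)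

  ℓ≡backward+right : ℓ σ i k ≡ backward + R
  ℓ≡backward+right = sym (if-float (_+ R) (does (L ≟ p)))

  leftBlock : LeftBlock σ i L
  leftBlock = proj₁ (max-filter-upTo (leftBlock? σ i) n
    (z≤n , λ t p≤t t<p → contradiction t<p (≤⇒≯ p≤t)))

  left-maximal : ∀ {m} → LeftBlock σ i m → m ≤ L
  left-maximal block = proj₂ (max-filter-upTo (leftBlock? σ i) n
    (z≤n , λ t p≤t t<p → contradiction t<p (≤⇒≯ p≤t)))
    (≤-trans (proj₁ block) (<⇒≤ (Fin.toℕ<n i))) block

  rightBlock-empty : RightBlock σ i k 0
  rightBlock-empty = (≤-trans (≤-reflexive (+-identityʳ p)) (<⇒≤ (Fin.toℕ<n i)) , z≤n) ,
    λ t p≤t t<p+0 → contradiction (subst (toℕ t <_) (+-identityʳ p) t<p+0) (≤⇒≯ p≤t)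

  rightBlock : RightBlock σ i k R
  rightBlock = proj₁ (max-filter-upTo (rightBlock? σ i k) n rightBlock-empty)

  right-maximal : ∀ {m} → RightBlock σ i k m → m ≤ R
  right-maximal block = proj₂ (max-filter-upTo (rightBlock? σ i k) n rightBlock-empty)
    (m+n≤o⇒n≤o p (proj₁ (proj₁ block))) block

  backward≤left : backward ≤ L
  backward≤left with L ≟ p
  ... | yes L≡p = ≤-reflexive (backward-full L≡p)
  ... | no  L≢p = ≤-trans (≤-reflexive (backward-partial L≢p)) (m∸n≤m L k)

  i∉occ : i ∉ₛ occ
  i∉occ i∈occ = <-irrefl refl (occ⁻ i i∈occ)

  left-occupied : ∀ b → p ∸ L ≤ toℕ b → b Fin.< i → b ∈ₛ occ
  left-occupied b p∸L≤b b<i = occ⁺ b (proj₂ leftBlock b p∸L≤b b<i)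

  right-occupied : ∀ b → i Fin.< b → toℕ b < p + R → b ∈ₛ occ
  -- A right block only gives a weak inequality, because it contains `i` itself; injectivity of `σ`
  -- makes it strict at `b`, which differs from `i`.
  right-occupied b i<b b<p+R = occ⁺ b (≤∧≢⇒< (proj₂ rightBlock b (<⇒≤ i<b) b<p+R)
    (λ eq → <⇒≢ i<b (cong toℕ (sym (σ-injective (Fin.toℕ-injective eq))))))

  -- If `a` is at or above `i`, the car backs down over occupied spots only and over at most `k` of
  -- them, so the positions from `i` to `a` form a right block. Its length is `a - i + 1`, since `i`
  -- is counted.
  Reaches⇒<right : ∀ {a} → Reaches k occ a i → toℕ a < p + R
  Reaches⇒<right {a} (a≤p+k , above , _) with <-≤-connex (toℕ a) p
  ... | inj₁ a<p = m≤n⇒m≤n+o R a<p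
  ... | inj₂ p≤a = begin-strict
    toℕ a                    ≡⟨ m+[n∸m]≡n p≤a ⟨
    p + (toℕ a ∸ p)          <⟨ +-monoʳ-< p (right-maximal block) ⟩
    p + R                    ∎
    where
    open ≤-Reasoning
    p+suc≡ : p + suc (toℕ a ∸ p) ≡ suc (toℕ a)
    p+suc≡ = trans (+-suc p _) (cong suc (m+[n∸m]≡n p≤a))
    block : RightBlock σ i k (suc (toℕ a ∸ p))
    block = (subst (_≤ n) (sym p+suc≡) (Fin.toℕ<n a) , s≤s (m≤n+o⇒m∸n≤o (toℕ a) p a≤p+k)) , smaller
      where
      smaller : ∀ t → i Fin.≤ t → toℕ t < p + suc (toℕ a ∸ p) → lookup σ t Fin.≤ lookup σ i
      smaller t i≤t t<p+ with i Fin.≟ t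
      ... | yes refl = ≤-refl
      ... | no i≢t   = <⇒≤ (occ⁻ t (above t (≤∧≢⇒< i≤t (i≢t ∘ Fin.toℕ-injective))
                         (s≤s⁻¹ (subst (toℕ t <_) p+suc≡ t<p+))))

  -- If `a` is below `i`, the car examines everything from `a ∸ k` up to `i` and finds it occupied,
  -- so these spots form a left block and `p ≤ L + (a ∸ k)`. When `L` falls short of `p`, neither
  -- subtraction may hide a truncation: `k ≤ a` gives `p + k ≤ L + a`, hence `p ≤ (L ∸ k) + a`.
  Reaches⇒left≤ : ∀ {a} → Reaches k occ a i → p ∸ backward ≤ toℕ a
  Reaches⇒left≤ {a} (_ , _ , below) with <-≤-connex (toℕ a) p
  ... | inj₂ p≤a = ≤-trans (m∸n≤m p backward) p≤a
  ... | inj₁ a<p with L ≟ p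
  ...   | yes L≡p = ≤-trans
    (≤-reflexive (trans (cong (p ∸_) (trans (backward-full L≡p) L≡p)) (n∸n≡0 p))) z≤n
  ...   | no L≢p = subst (λ z → p ∸ z ≤ toℕ a) (sym (backward-partial L≢p)) (m≤n+o⇒m∸n≤o p (L ∸ k) (+-cancelʳ-≤ k p _ (begin
    p + k                        ≤⟨ +-monoˡ-≤ k p≤L+[a∸k] ⟩
    L + (toℕ a ∸ k) + k          ≡⟨ +-assoc L _ k ⟩
    L + (toℕ a ∸ k + k)          ≡⟨ cong (L +_) (m∸n+n≡m k≤a) ⟩
    L + toℕ a                    ≤⟨ +-monoˡ-≤ (toℕ a) (m≤n+m∸n L k) ⟩
    k + (L ∸ k) + toℕ a          ≡⟨ +-assoc k _ _ ⟩
    k + (L ∸ k + toℕ a)          ≡⟨ +-comm k _ ⟩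
    L ∸ k + toℕ a + k            ∎)))
    where
    open ≤-Reasoning
    a∸k≤p : toℕ a ∸ k ≤ p
    a∸k≤p = ≤-trans (m∸n≤m (toℕ a) k) (<⇒≤ a<p)
    block : LeftBlock σ i (p ∸ (toℕ a ∸ k))
    block = m∸n≤m p (toℕ a ∸ k) , λ t ≤t t<i → occ⁻ t (below a<p t t<i
      (≤-trans (m≤n+m∸n (toℕ a) k) (≤-trans (+-monoʳ-≤ k (subst (_≤ toℕ t) (m∸[m∸n]≡n a∸k≤p) ≤t))
        (≤-reflexive (+-comm k (toℕ t))))))
    p≤L+[a∸k] : p ≤ L + (toℕ a ∸ k)
    p≤L+[a∸k] = ≤-trans (m≤n+m∸n p (toℕ a ∸ k)) (≤-trans (+-monoʳ-≤ (toℕ a ∸ k) (left-maximal block))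
      (≤-reflexive (+-comm (toℕ a ∸ k) L)))
    -- Otherwise `a ∸ k` would be 0 and the left block would extend to the first spot, forcing `L`
    -- to equal `p`.
    k≤a : k ≤ toℕ a
    k≤a with ≤-total k (toℕ a)
    ... | inj₁ k≤a = k≤a
    ... | inj₂ a≤k = contradiction (≤-antisym (proj₁ leftBlock)
      (≤-trans p≤L+[a∸k] (≤-reflexive (trans (cong (L +_) (m≤n⇒m∸n≡0 a≤k)) (+-identityʳ L))))) L≢p

  interval⇒Reaches : ∀ {a} → p ∸ backward ≤ toℕ a × toℕ a < p + R → Reaches k occ a i
  interval⇒Reaches {a} (left≤a , a<right) = a≤p+k , above , below
    where
    open ≤-Reasoning
    a≤p+k : toℕ a ≤ p + k
    -- A right block counts `i` itself, so its length is at most `k + 1`; the strict bound on `a`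
    -- absorbs the extra one.
    a≤p+k = s≤s⁻¹ (begin
      suc (toℕ a)  ≤⟨ a<right ⟩
      p + R        ≤⟨ +-monoʳ-≤ p (proj₂ (proj₁ rightBlock)) ⟩
      p + suc k    ≡⟨ +-suc p k ⟩
      suc (p + k)  ∎)
    above : ∀ b → i Fin.< b → b Fin.≤ a → b ∈ₛ occ
    above b i<b b≤a = right-occupied b i<b (≤-<-trans b≤a a<right)
    below : a Fin.< i → ∀ b → b Fin.< i → toℕ a ≤ toℕ b + k → b ∈ₛ occ
    below a<i b b<i a≤b+k with L ≟ p
    ... | yes L≡p = left-occupied b (≤-trans (≤-reflexive (trans (cong (p ∸_) L≡p) (n∸n≡0 p))) z≤n) b<i
    ... | no L≢p = left-occupied b (m≤n+o⇒m∸n≤o p L (begin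
      p                        ≤⟨ p≤[L∸k]+a ⟩
      L ∸ k + toℕ a            ≤⟨ +-monoʳ-≤ (L ∸ k) a≤b+k ⟩
      L ∸ k + (toℕ b + k)      ≡⟨ cong (L ∸ k +_) (+-comm (toℕ b) k) ⟩
      L ∸ k + (k + toℕ b)      ≡⟨ +-assoc (L ∸ k) k _ ⟨
      L ∸ k + k + toℕ b        ≡⟨ cong (_+ toℕ b) (m∸n+n≡m k≤L) ⟩
      L + toℕ b                ∎)) b<i
      where
      p≤[L∸k]+a : p ≤ L ∸ k + toℕ a
      p≤[L∸k]+a = ≤-trans (m≤n+m∸n p (L ∸ k)) (+-monoʳ-≤ (L ∸ k)
        (subst (λ z → p ∸ z ≤ toℕ a) (backward-partial L≢p) left≤a))
      -- Were `L ∸ k` equal to 0, the lower bound on `a` would become `p ≤ a`, against `a < i`.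
      k≤L : k ≤ L
      k≤L with ≤-total k L
      ... | inj₁ k≤L = k≤L
      ... | inj₂ L≤k = contradiction (subst (λ z → p ≤ z + toℕ a) (m≤n⇒m∸n≡0 L≤k) p≤[L∸k]+a) (<⇒≱ a<i)

  -- The successful preferences are the half-open interval from `p ∸ backward` to `p + R`. It lies
  -- inside the street because a right block does, and `p ∸ backward` is a true difference because
  -- `backward ≤ L ≤ p`, so the length is `backward + R`.
  preferences≡ℓ : preferences k occ i ≡ ℓ σ i k
  preferences≡ℓ = begin
    length (filter (λ a → parkCar k occ a ≟ₘ just i) (allFin n))
      ≡⟨ cong length (List.filter-≐ (λ a → parkCar k occ a ≟ₘ just i)
           (inInterval? (p ∸ backward) (p + R)) (to , from) (allFin n)) ⟩
    length (filter (inInterval? (p ∸ backward) (p + R)) (allFin n))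
      ≡⟨ length-interval n _ _ (proj₁ (proj₁ rightBlock)) ⟩
    p + R ∸ (p ∸ backward)
      ≡⟨ cong (λ z → z + R ∸ (p ∸ backward)) (m∸n+n≡m (≤-trans backward≤left (proj₁ leftBlock))) ⟨
    p ∸ backward + backward + R ∸ (p ∸ backward)
      ≡⟨ cong (_∸ (p ∸ backward)) (+-assoc (p ∸ backward) backward R) ⟩
    p ∸ backward + (backward + R) ∸ (p ∸ backward)
      ≡⟨ m+n∸m≡n (p ∸ backward) _ ⟩
    backward + R
      ≡⟨ ℓ≡backward+right ⟨
    ℓ σ i k ∎
    where
    open ≡-Reasoning
    to : ∀ {a} → parkCar k occ a ≡ just i → p ∸ backward ≤ toℕ a × toℕ a < p + R
    to {a} eq = Reaches⇒left≤ reaches , Reaches⇒<right reaches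
      where reaches = parkCar⇒Reaches k occ a eq
    from : ∀ {a} → p ∸ backward ≤ toℕ a × toℕ a < p + R → parkCar k occ a ≡ just i
    from {a} inside = Reaches⇒parkCar k occ a i∉occ (interval⇒Reaches inside)

-- Summing over the sequences of spots taken by the cars

-- The number of preference words that make the cars take exactly the spots `ss` in turn: once the
-- outcome is fixed, each car's choice is independent of the others.
outcomeWeight : ℕ → Subset n → Vec (Fin n) m → ℕ
outcomeWeight k occ []       = 1
outcomeWeight k occ (s ∷ ss) = preferences k occ s * outcomeWeight k (occ ∪ ⁅ s ⁆) ss

parked : Maybe (Subset n) → ℕ
parked = maybe′ (λ _ → 1) 0

-- Induction on the number of cars still to come. The rest of the process sees the first preference
-- only through the spot it leads to, so grouping by that spot produces the factor `preferences`.
∑-parked : ∀ k m (occ : Subset n) →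
  ∑ (words n m) (parked ∘ parkAll k occ) ≡ ∑ (words n m) (outcomeWeight k occ)
∑-parked k zero    occ = refl
∑-parked {n} k (suc m) occ = begin
  ∑ (words n (suc m)) (parked ∘ parkAll k occ)
    ≡⟨ ∑-cartesianProductWith _∷_ (parked ∘ parkAll k occ) (allFin n) (words n m) ⟩
  ∑ (allFin n) (λ a → ∑ (words n m) (λ w → parked (parkCar k occ a >>= continue w)))
    ≡⟨ ∑-cong (allFin n) (λ a → after (parkCar k occ a)) ⟩
  ∑ (allFin n) (maybe′ (λ s → ∑ (words n m) (outcomeWeight k (occ ∪ ⁅ s ⁆))) 0 ∘ parkCar k occ)
    ≡⟨ ∑-fibres (parkCar k occ) _ (allFin n) ⟩
  ∑ (allFin n) (λ s → preferences k occ s * ∑ (words n m) (outcomeWeight k (occ ∪ ⁅ s ⁆)))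
    ≡⟨ ∑-cong (allFin n) (λ s → ∑-*ˡ (preferences k occ s) _ (words n m)) ⟨
  ∑ (allFin n) (λ s → ∑ (words n m) (λ ss → preferences k occ s * outcomeWeight k (occ ∪ ⁅ s ⁆) ss))
    ≡⟨ ∑-cartesianProductWith _∷_ (outcomeWeight k occ) (allFin n) (words n m) ⟨
  ∑ (words n (suc m)) (outcomeWeight k occ) ∎
  where
  open ≡-Reasoning
  continue : Vec (Fin n) m → Fin n → Maybe (Subset n)
  continue w s = parkAll k (occ ∪ ⁅ s ⁆) w
  after : ∀ x → ∑ (words n m) (λ w → parked (x >>= continue w)) ≡
    maybe′ (λ s → ∑ (words n m) (outcomeWeight k (occ ∪ ⁅ s ⁆))) 0 x
  after (just s) = ∑-parked k m (occ ∪ ⁅ s ⁆)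
  after nothing  = ∑-zero (words n m)

length-PF : ∀ n k → length (PF n k) ≡ ∑ (words n n) (outcomeWeight k Subset.⊥)
length-PF n k = begin
  length (PF n k)
    ≡⟨ length-filter≡∑ (isNaplesPF? k) (words n n) ⟩
  ∑ (words n n) (λ α → 𝟙 (does (isNaplesPF? k α)))
    ≡⟨ ∑-cong (words n n) (λ α → indicator (parkAll k Subset.⊥ α)) ⟩
  ∑ (words n n) (parked ∘ parkAll k Subset.⊥)
    ≡⟨ ∑-parked k n Subset.⊥ ⟩
  ∑ (words n n) (outcomeWeight k Subset.⊥) ∎
  where
  open ≡-Reasoning
  indicator : ∀ (x : Maybe (Subset n)) →
    𝟙 (does (MaybeAny.dec (λ _ → yes tt) x)) ≡ parked x
  indicator (just _) = refl
  indicator nothing  = refl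

-- A car never takes an occupied spot, so a repetition makes some factor vanish. Avoidance of `occ`
-- is carried along for the induction: since `s` joins the occupied set, avoidance by the tail says
-- that `s` does not recur.
outcomeWeight≢0⇒distinct : ∀ k (occ : Subset n) (ss : Vec (Fin n) m) → outcomeWeight k occ ss ≢ 0 →
  (∀ t → lookup ss t ∉ₛ occ) × Injective _≡_ _≡_ (lookup ss)
outcomeWeight≢0⇒distinct k occ []       _   = (λ ()) , λ { {()} }
outcomeWeight≢0⇒distinct k occ (s ∷ ss) w≢0
  with avoids , injective ← outcomeWeight≢0⇒distinct k (occ ∪ ⁅ s ⁆) ss
         (λ w≡0 → w≢0 (trans (cong (preferences k occ s *_) w≡0) (*-zeroʳ (preferences k occ s))))
  = avoids′ , injective′
  where
  avoids′ : ∀ t → lookup (s ∷ ss) t ∉ₛ occ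
  avoids′ zero    s∈occ = w≢0 (cong (_* outcomeWeight k (occ ∪ ⁅ s ⁆) ss) (preferences-occupied k occ s∈occ))
  avoids′ (suc t) ∈occ  = avoids t (Subset.x∈p∪q⁺ (inj₁ ∈occ))
  s≢ : ∀ t → s ≢ lookup ss t
  s≢ t s≡ = avoids t (Subset.x∈p∪q⁺ (inj₂ (subst (_∈ₛ ⁅ s ⁆) s≡ (Subset.x∈⁅x⁆ s))))
  injective′ : Injective _≡_ _≡_ (lookup (s ∷ ss))
  injective′ {zero}  {zero}  _  = refl
  injective′ {zero}  {suc u} eq = contradiction eq (s≢ u)
  injective′ {suc t} {zero}  eq = contradiction (sym eq) (s≢ t)
  injective′ {suc t} {suc u} eq = cong suc (injective eq)

-- Pigeonhole: if `y` were missed, `punchOut` at `y` would turn `f` into an injection of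
-- `Fin (suc n)` into `Fin n`.
injective⇒hits : ∀ (f : Fin n → Fin n) → Injective _≡_ _≡_ f → ∀ y → ∃ λ x → f x ≡ y
injective⇒hits {suc n} f inj y with Fin.any? (λ x → f x Fin.≟ y)
... | yes hit  = hit
... | no ¬hit = contradiction
  (Fin.injective⇒≤ {f = λ x → punchOut (y≢f x)} (λ eq → inj (Fin.punchOut-injective (y≢f _) (y≢f _) eq)))
  1+n≰n
  where
  y≢f : ∀ x → y ≢ f x
  y≢f x y≡fx = ¬hit (x , sym y≡fx)

nonPermutation⇒outcomeWeight≡0 : ∀ k (ss : Vec (Fin n) n) → ¬ IsPermutation ss →
  outcomeWeight k Subset.⊥ ss ≡ 0
nonPermutation⇒outcomeWeight≡0 k ss ¬perm with outcomeWeight k Subset.⊥ ss ≟ 0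
... | yes w≡0 = w≡0
... | no  w≢0 = ⊥-elim (¬perm
  (injective , strictlySurjective⇒surjective (injective⇒hits (lookup ss) injective)))
  where
  injective : Injective _≡_ _≡_ (lookup ss)
  injective = proj₂ (outcomeWeight≢0⇒distinct k Subset.⊥ ss w≢0)

-- The set met by car `t` is described by its members instead of being computed. In the inductive
-- step the spot `s` then moves freely between the initially occupied spots and those taken by
-- earlier cars.
outcomeWeight-product : ∀ k (f : Fin n → ℕ) (occ : Subset n) (ss : Vec (Fin n) m) →
  (∀ t (occ′ : Subset n) →
    (∀ x → x ∈ₛ occ′ ⇔ (x ∈ₛ occ ⊎ ∃ λ u → u Fin.< t × lookup ss u ≡ x)) →
    preferences k occ′ (lookup ss t) ≡ f (lookup ss t)) →
  outcomeWeight k occ ss ≡ product (tabulate (f ∘ lookup ss))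
outcomeWeight-product k f occ []       _ = refl
outcomeWeight-product k f occ (s ∷ ss) h = cong₂ _*_
  (h zero occ (λ x → mk⇔ inj₁ [ id , (λ { (_ , () , _) }) ]′))
  (outcomeWeight-product k f (occ ∪ ⁅ s ⁆) ss λ t occ′ iff → h (suc t) occ′ λ x →
    mk⇔ (to t x ∘ Equivalence.to (iff x)) (Equivalence.from (iff x) ∘ from t x))
  where
  to : ∀ t x → (x ∈ₛ occ ∪ ⁅ s ⁆ ⊎ ∃ λ u → u Fin.< t × lookup ss u ≡ x) →
    x ∈ₛ occ ⊎ ∃ λ u → u Fin.< suc t × lookup (s ∷ ss) u ≡ x
  to t x (inj₂ (u , u<t , eq)) = inj₂ (suc u , s≤s u<t , eq)
  to t x (inj₁ x∈) with Subset.x∈p∪q⁻ occ ⁅ s ⁆ x∈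
  ... | inj₁ x∈occ = inj₁ x∈occ
  ... | inj₂ x∈s   = inj₂ (zero , s≤s z≤n , sym (Subset.x∈⁅y⁆⇒x≡y s x∈s))
  from : ∀ t x → (x ∈ₛ occ ⊎ ∃ λ u → u Fin.< suc t × lookup (s ∷ ss) u ≡ x) →
    x ∈ₛ occ ∪ ⁅ s ⁆ ⊎ ∃ λ u → u Fin.< t × lookup ss u ≡ x
  from t x (inj₁ x∈occ)                     = inj₁ (Subset.x∈p∪q⁺ (inj₁ x∈occ))
  from t x (inj₂ (zero , _ , refl))         = inj₁ (Subset.x∈p∪q⁺ (inj₂ (Subset.x∈⁅x⁆ x)))
  from t x (inj₂ (suc u , s≤s u<t , eq))    = inj₂ (u , u<t , eq)

-- Inverse permutations

-- Junk value y if y is not in the image of σ.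
preimage : Vec (Fin n) n → Fin n → Fin n
preimage σ y with Fin.any? (λ x → lookup σ x Fin.≟ y)
... | yes (x , _) = x
... | no _        = y

lookup-preimage : ∀ (σ : Vec (Fin n) n) {x y} → lookup σ x ≡ y → lookup σ (preimage σ y) ≡ y
lookup-preimage σ {x} {y} σx≡y with Fin.any? (λ x → lookup σ x Fin.≟ y)
... | yes (_ , eq) = eq
... | no ¬hit      = contradiction (x , σx≡y) ¬hit

inverse : Vec (Fin n) n → Vec (Fin n) n
inverse σ = Vec.tabulate (preimage σ)

module _ (σ : Vec (Fin n) n) (perm : IsPermutation σ) where

  lookup-inverseˡ : ∀ y → lookup σ (lookup (inverse σ) y) ≡ y
  lookup-inverseˡ y = trans (cong (lookup σ) (Vec.lookup∘tabulate (preimage σ) y))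
    (lookup-preimage σ (proj₂ (proj₂ perm y) refl))

  lookup-inverseʳ : ∀ x → lookup (inverse σ) (lookup σ x) ≡ x
  lookup-inverseʳ x = proj₁ perm (lookup-inverseˡ (lookup σ x))

  inverse-isPermutation : IsPermutation (inverse σ)
  inverse-isPermutation =
    (λ {x} {y} eq → trans (sym (lookup-inverseˡ x)) (trans (cong (lookup σ) eq) (lookup-inverseˡ y))) ,
    strictlySurjective⇒surjective (λ x → lookup σ x , lookup-inverseʳ x)

inverse-involutive : ∀ (σ : Vec (Fin n) n) → IsPermutation σ → inverse (inverse σ) ≡ σ
inverse-involutive σ perm = begin
  inverse (inverse σ)                          ≡⟨ Vec.tabulate∘lookup _ ⟨
  Vec.tabulate (lookup (inverse (inverse σ)))  ≡⟨ Vec.tabulate-cong pointwise ⟩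
  Vec.tabulate (lookup σ)                      ≡⟨ Vec.tabulate∘lookup σ ⟩
  σ                                            ∎
  where
  open ≡-Reasoning
  pointwise : ∀ x → lookup (inverse (inverse σ)) x ≡ lookup σ x
  pointwise x = trans (sym (lookup-inverseˡ σ perm _))
    (cong (lookup σ) (lookup-inverseˡ (inverse σ) (inverse-isPermutation σ perm) x))

-- Two duplicate-free lists with the same members are permutations of each other. That `map f xs`
-- has no duplicates follows because mapping `g` over it gives back `xs`.
map-↭ : ∀ {f g : A → A} {xs} → Unique xs →
  (∀ {x} → x ∈ xs → f x ∈ xs) → (∀ {x} → x ∈ xs → g x ∈ xs) →
  (∀ {x} → x ∈ xs → g (f x) ≡ x) → (∀ {x} → x ∈ xs → f (g x) ≡ x) → map f xs ↭ xs
map-↭ {f = f} {g} {xs} xs! f∈ g∈ gf≡id fg≡id =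
  ∼bag⇒↭ (unique∧set⇒bag map! xs! (λ {x} → mk⇔ to from))
  where
  map! : Unique (map f xs)
  map! = Unique.map⁻ {f = g} (subst Unique
    (sym (trans (sym (List.map-∘ xs)) (List.map-id-local (All.tabulate gf≡id)))) xs!)
  to : ∀ {x} → x ∈ map f xs → x ∈ xs
  to x∈ with _ , y∈ , refl ← ∈-map⁻ f x∈ = f∈ y∈
  from : ∀ {x} → x ∈ xs → x ∈ map f xs
  from x∈ = subst (_∈ map f xs) (fg≡id x∈) (∈-map⁺ f (g∈ x∈))

∈-S⁺ : ∀ {σ : Vec (Fin n) n} → IsPermutation σ → σ ∈ S n
∈-S⁺ {σ = σ} perm = ∈-filter⁺ isPermutation? (words-complete σ) perm

∈-S⁻ : ∀ {σ : Vec (Fin n) n} → σ ∈ S n → IsPermutation σ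
∈-S⁻ {n} σ∈ = proj₂ (∈-filter⁻ isPermutation? {xs = words n n} σ∈)

map-inverse-S : ∀ n → map inverse (S n) ↭ S n
map-inverse-S n = map-↭ {g = inverse} (Unique.filter⁺ isPermutation? (words-unique n n))
  inverse∈ inverse∈ involutive involutive
  where
  inverse∈ : ∀ {σ} → σ ∈ S n → inverse σ ∈ S n
  inverse∈ {σ} σ∈ = ∈-S⁺ (inverse-isPermutation σ (∈-S⁻ σ∈))
  involutive : ∀ {σ} → σ ∈ S n → inverse (inverse σ) ≡ σ
  involutive {σ} σ∈ = inverse-involutive σ (∈-S⁻ σ∈)

map-lookup-allFin : ∀ (σ : Vec (Fin n) n) → IsPermutation σ → map (lookup σ) (allFin n) ↭ allFin n
map-lookup-allFin {n} σ perm = map-↭ {g = lookup (inverse σ)} (Unique.allFin⁺ n)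
  (λ _ → ∈-allFin _) (λ _ → ∈-allFin _) (λ {x} _ → lookup-inverseʳ σ perm x) (λ {x} _ → lookup-inverseˡ σ perm x)

-- The weight of an outcome through its inverse permutation, and the final count

outcomeWeight-inverse : ∀ k (σ : Vec (Fin n) n) → IsPermutation σ →
  outcomeWeight k Subset.⊥ (inverse σ) ≡ product (map (λ i → ℓ σ i k) (allFin n))
outcomeWeight-inverse {n} k σ perm = begin
  outcomeWeight k Subset.⊥ (inverse σ)
    ≡⟨ outcomeWeight-product k ℓσ Subset.⊥ (inverse σ) counts ⟩
  product (tabulate (ℓσ ∘ lookup (inverse σ)))
    ≡⟨ cong product (List.map-tabulate id (ℓσ ∘ lookup (inverse σ))) ⟨
  product (map (ℓσ ∘ lookup (inverse σ)) (allFin n))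
    ≡⟨ cong product (List.map-∘ (allFin n)) ⟩
  product (map ℓσ (map (lookup (inverse σ)) (allFin n)))
    -- So far the factors are ordered by car; reindexing along `inverse σ` orders them by spot.
    ≡⟨ product-↭ (map⁺ ℓσ (map-lookup-allFin (inverse σ) (inverse-isPermutation σ perm))) ⟩
  product (map ℓσ (allFin n)) ∎
  where
  open ≡-Reasoning
  ℓσ : Fin n → ℕ
  ℓσ i = ℓ σ i k
  -- Car `t` finds occupied the spots of the cars `u < t`. Since `σ` sends a spot to its car, these
  -- are the spots `b` with `σ` at `b` below `t`, which is the situation of `preferences≡ℓ`.
  counts : ∀ t (occ : Subset n) →
    (∀ x → x ∈ₛ occ ⇔ (x ∈ₛ Subset.⊥ ⊎ ∃ λ u → u Fin.< t × lookup (inverse σ) u ≡ x)) →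
    preferences k occ (lookup (inverse σ) t) ≡ ℓσ (lookup (inverse σ) t)
  counts t occ iff = preferences≡ℓ k σ (proj₁ perm) (lookup (inverse σ) t) occ⁺ occ⁻
    where
    occ⁺ : ∀ b → lookup σ b Fin.< lookup σ (lookup (inverse σ) t) → b ∈ₛ occ
    occ⁺ b σb<t = Equivalence.from (iff b)
      (inj₂ (lookup σ b , subst (lookup σ b Fin.<_) (lookup-inverseˡ σ perm t) σb<t , lookup-inverseʳ σ perm b))
    occ⁻ : ∀ b → b ∈ₛ occ → lookup σ b Fin.< lookup σ (lookup (inverse σ) t)
    occ⁻ b b∈occ with Equivalence.to (iff b) b∈occ
    ... | inj₁ b∈⊥ = contradiction b∈⊥ Subset.∉⊥
    ... | inj₂ (u , u<t , refl) = subst (Fin._< lookup σ (lookup (inverse σ) t)) (sym (lookup-inverseˡ σ perm u))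
      (subst (u Fin.<_) (sym (lookup-inverseˡ σ perm t)) u<t)

theorem3p13 : (n k : ℕ) → 1 ≤ n → k ≤ n ∸ 1 →
    length (PF n k) ≡ sum (map (λ σ → product (map (λ i → ℓ σ i k) (allFin n))) (S n))
theorem3p13 n k _ _ = begin
  length (PF n k)
    ≡⟨ length-PF n k ⟩
  ∑ (words n n) (outcomeWeight k Subset.⊥)
    -- Outcomes that are not permutations repeat a spot and weigh 0.
    ≡⟨ ∑-filter isPermutation? (words n n) (nonPermutation⇒outcomeWeight≡0 k) ⟨
  ∑ (S n) (outcomeWeight k Subset.⊥)
    -- An outcome assigns spots to cars, whereas the statistics read a permutation as assigning cars
    -- to spots; inversion permutes `S n`, so the sum may be taken over inverses.
    ≡⟨ sum-↭ (map⁺ (outcomeWeight k Subset.⊥) (map-inverse-S n)) ⟨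
  ∑ (map inverse (S n)) (outcomeWeight k Subset.⊥)
    ≡⟨ cong sum (List.map-∘ (S n)) ⟨
  ∑ (S n) (outcomeWeight k Subset.⊥ ∘ inverse)
    ≡⟨ cong sum (List.map-cong-local {xs = S n} (All.tabulate λ {σ} σ∈ → outcomeWeight-inverse k σ (∈-S⁻ σ∈))) ⟩
  ∑ (S n) (λ σ → product (map (λ i → ℓ σ i k) (allFin n))) ∎
  where open ≡-Reasoning
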